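{- Suppose that for all integers $k \ge 0$ and $\ell \ge 3$ there exists an integer $f(k,\ell) \ge 0$ such that every tournament $T$ with $\overrightarrow{\chi}(T) \ge f(k,\ell)$ contains a subdigraph $H \subseteq T$ with $\overrightarrow{\chi}(H) > k$ and $\mathrm{girth}(H) > \ell$. Then for all integers $k \ge 0$ and $\ell \ge 3$ there exists an integer $f'(k,\ell) \ge 0$ such that every graph $G$ with $\chi(G) \ge f'(k,\ell)$ contains a subgraph $H \subseteq G$ with $\chi(H) > k$ and $\mathrm{girth}(H) > \ell$.
   Context: All graphs and digraphs are finite; graphs are simple and undirected. A tournament is a digraph with exactly one arc between every pair of distinct vertices (and no loops). Subgraphs and subdigraphs are not necessarily induced. $\chi(G)$ denotes the chromatic number of a graph $G$. The dichromatic number $\overrightarrow{\chi}(D)$ of a digraph $D$ is the least integer $k \ge 0$ such that the vertices of $D$ can be partitioned into $k$ sets each inducing an acyclic subdigraph (no directed cycle). The girth $\mathrm{girth}(G)$ of a graph $G$ is the minimum size of a cycle in $G$ ($+\infty$ if $G$ has no cycle). The girth $\mathrm{girth}(D)$ of a digraph $D$ is the girth of its underlying undirected graph. -}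

module Defs where

open import Data.Fin using (Fin; zero; suc; toℕ; _≟_)
open import Data.Fin.Properties using (any?; all?; injective⇒≤)
open import Data.Nat using (ℕ; zero; suc; _≤_; _<_; _≤?_; z≤n; s≤s)
open import Data.Nat.DivMod using (_mod_)
open import Data.Nat.Properties using (<-≤-trans; anyUpTo?)
open import Data.Product using (∃; _×_; _,_; proj₁; proj₂)
open import Data.Sum using (_⊎_; inj₁; inj₂; swap)
open import Data.Vec using (Vec; []; _∷_; lookup; tabulate)
open import Data.Vec.Properties using (lookup∘tabulate)
open import Function using (_∘_; id)
open import Function.Definitions using (Injective)
open import Level using (0ℓ)
open import Relation.Binary using (Rel; Symmetric; Irreflexive)
import Relation.Binary as B
open import Relation.Binary.Construct.Add.Supremum.Strict _<_ using (_<⁺_; [_]; [_]<⊤⁺)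
open import Relation.Binary.PropositionalEquality
  using (_≡_; _≢_; _≗_; refl; sym; trans; subst₂)
open import Relation.Nullary using (¬_; Dec; yes; no; contradiction)
open import Relation.Nullary.Construct.Add.Supremum using (_⁺; ⊤⁺; [_])
open import Relation.Nullary.Decidable using (map′; ¬?; _×-dec_; _⊎-dec_; _→-dec_)
open import Relation.Unary using (Pred; Decidable)

------------------------------------------------------------------------
-- Least elements and finite search

IsLeast : Pred ℕ 0ℓ → Pred ℕ 0ℓ
IsLeast P m = P m × (∀ j → P j → m ≤ j)

least : {P : Pred ℕ 0ℓ} → Decidable P → ∃ P → ∃ (IsLeast P)
least P? (m , p) = search P? m p
  where
  search : {P : Pred ℕ 0ℓ} → Decidable P → ∀ m → P m → ∃ (IsLeast P)
  search P? zero p = zero , p , λ _ _ → z≤n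
  search P? (suc m) p with P? 0
  ... | yes p₀ = zero , p₀ , λ _ _ → z≤n
  ... | no ¬p₀ with search (P? ∘ suc) m p
  ...   | m′ , p′ , minimal = suc m′ , p′ , λ where
          zero    q → contradiction q ¬p₀
          (suc j) q → s≤s (minimal j q)

anyVec? : ∀ m {n} {P : Pred (Vec (Fin n) m) 0ℓ} → Decidable P → Dec (∃ P)
anyVec? zero P? = map′ ([] ,_) (λ { ([] , p) → p }) (P? [])
anyVec? (suc m) P? =
  map′ (λ { (x , xs , p) → x ∷ xs , p }) (λ { (x ∷ xs , p) → x , xs , p })
       (any? λ x → anyVec? m λ xs → P? (x ∷ xs))

anyFun? : ∀ {m n} {P : Pred (Fin m → Fin n) 0ℓ} →
          (∀ {f g} → f ≗ g → P f → P g) → Decidable P → Dec (∃ P)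
anyFun? {m} resp P? =
  map′ (λ { (v , p) → lookup v , p })
       (λ { (f , p) → tabulate f , resp (λ i → sym (lookup∘tabulate f i)) p })
       (anyVec? m (P? ∘ lookup))

------------------------------------------------------------------------
-- Cycles of a relation on a finite set

next : ∀ {m} → Fin m → Fin m
next {suc m} i = suc (toℕ i) mod suc m

record IsCycle {n} (R : Rel (Fin n) 0ℓ) {m} (c : Fin m → Fin n) : Set where
  field
    distinct    : Injective _≡_ _≡_ c
    consecutive : ∀ i → R (c i) (c (next i))

HasCycle : ∀ {n} → Rel (Fin n) 0ℓ → ℕ → Set
HasCycle {n} R m = ∃ λ (c : Fin m → Fin n) → IsCycle R c

-- The bound 1 ≤ m only excludes the empty sequence of vertices.
Acyclic : ∀ {n} → Rel (Fin n) 0ℓ → Set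
Acyclic R = ∀ m → 1 ≤ m → ¬ HasCycle R m

-- The arcs of the subdigraph induced by S; the vertices outside S are kept
-- as isolated vertices, which affects no cycle.
Induced : ∀ {n} → Rel (Fin n) 0ℓ → Pred (Fin n) 0ℓ → Rel (Fin n) 0ℓ
Induced R S u v = R u v × S u × S v

hasCycle⇒≤ : ∀ {n m} {R : Rel (Fin n) 0ℓ} → HasCycle R m → m ≤ n
hasCycle⇒≤ (c , cyc) = injective⇒≤ (IsCycle.distinct cyc)

isCycle? : ∀ {n} {R : Rel (Fin n) 0ℓ} → B.Decidable R →
           ∀ {m} (c : Fin m → Fin n) → Dec (IsCycle R c)
isCycle? R? c =
  map′ (λ { (inj , con) → record { distinct = λ {i} {j} → inj i j ; consecutive = con } })
       (λ cyc → (λ i j → IsCycle.distinct cyc {i} {j}) , IsCycle.consecutive cyc)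
       ((all? λ i → all? λ j → (c i ≟ c j) →-dec (i ≟ j))
         ×-dec (all? λ i → R? (c i) (c (next i))))

isCycle-resp : ∀ {n} {R : Rel (Fin n) 0ℓ} {m} {c d : Fin m → Fin n} →
               c ≗ d → IsCycle R c → IsCycle R d
isCycle-resp {R = R} c≗d cyc = record
  { distinct    = λ {i} {j} eq →
      IsCycle.distinct cyc (trans (c≗d i) (trans eq (sym (c≗d j))))
  ; consecutive = λ i → subst₂ R (c≗d i) (c≗d (next i)) (IsCycle.consecutive cyc i)
  }

hasCycle? : ∀ {n} {R : Rel (Fin n) 0ℓ} → B.Decidable R → Decidable (HasCycle R)
hasCycle? R? m = anyFun? isCycle-resp (isCycle? R?)

anyLongCycle? : ∀ {n} {R : Rel (Fin n) 0ℓ} → B.Decidable R →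
                ∀ l → Dec (∃ λ m → l ≤ m × HasCycle R m)
anyLongCycle? {n} R? l =
  map′ (λ { (m , _ , p) → m , p })
       (λ { (m , p) → m , s≤s (hasCycle⇒≤ (proj₂ p)) , p })
       (anyUpTo? (λ m → (l ≤? m) ×-dec hasCycle? R? m) (suc n))

acyclic? : ∀ {n} {R : Rel (Fin n) 0ℓ} → B.Decidable R → Dec (Acyclic R)
acyclic? R? = map′ (λ ¬e m 1≤m h → ¬e (m , 1≤m , h))
                   (λ { acyc (m , 1≤m , h) → acyc m 1≤m h })
                   (¬? (anyLongCycle? R? 1))

acyclic-mono : ∀ {n} {R S : Rel (Fin n) 0ℓ} → (∀ {u v} → S u v → R u v) →
               Acyclic R → Acyclic S
acyclic-mono S⊆R acyc m 1≤m (c , cyc) = acyc m 1≤m (c , record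
  { distinct    = IsCycle.distinct cyc
  ; consecutive = λ i → S⊆R (IsCycle.consecutive cyc i) })

------------------------------------------------------------------------
-- Graphs, chromatic number, girth

-- Every finite set is in bijection with some Fin n, and classically the
-- decidability field is no restriction.
record Graph : Set₁ where
  field
    order  : ℕ
  Vertex : Set
  Vertex = Fin order
  field
    _~_    : Rel Vertex 0ℓ
    ~-sym  : Symmetric _~_
    ~-irr  : Irreflexive _≡_ _~_
    _~?_   : B.Decidable _~_

-- H ⊆ᴳ G: H is, up to renaming its vertices, a (not necessarily induced)
-- subgraph of G.
record _⊆ᴳ_ (H G : Graph) : Set where
  private
    module H = Graph H
    module G = Graph G
  field
    embed     : H.Vertex → G.Vertex
    injective : Injective _≡_ _≡_ embed
    edges     : ∀ {u v} → u H.~ v → embed u G.~ embed v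

module _ (G : Graph) where
  open Graph G

  IsColouring : ∀ {k} → (Vertex → Fin k) → Set
  IsColouring c = ∀ u v → u ~ v → c u ≢ c v

  Colourable : ℕ → Set
  Colourable k = ∃ λ (c : Vertex → Fin k) → IsColouring c

  colourable? : Decidable Colourable
  colourable? k = anyFun?
    (λ f≗g col u v u~v eq → col u v u~v (trans (f≗g u) (trans eq (sym (f≗g v)))))
    (λ c → all? λ u → all? λ v → (u ~? v) →-dec ¬? (c u ≟ c v))

  order-colourable : Colourable order
  order-colourable = id , λ u v u~v u≡v → ~-irr u≡v u~v

  private
    leastColouring : ∃ (IsLeast Colourable)
    leastColouring = least colourable? (order , order-colourable)

  χ : ℕ
  χ = proj₁ leastColouring

  χ-isLeast : IsLeast Colourable χ
  χ-isLeast = proj₂ leastColouring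

  -- Without 3 ≤ m every edge would count as a cycle of length 2.
  HasGraphCycle : ℕ → Set
  HasGraphCycle m = 3 ≤ m × HasCycle _~_ m

  hasGraphCycle? : Decidable HasGraphCycle
  hasGraphCycle? m = (3 ≤? m) ×-dec hasCycle? _~?_ m

  girth : ℕ ⁺
  girth with anyLongCycle? _~?_ 3
  ... | yes cycle = [ proj₁ (least hasGraphCycle? cycle) ]
  ... | no  _     = ⊤⁺

  <girth⇒ : ∀ {ℓ} → [ ℓ ] <⁺ girth → ∀ m → HasGraphCycle m → ℓ < m
  <girth⇒ ℓ<g m h with anyLongCycle? _~?_ 3
  <girth⇒ [ ℓ<g ] m h | yes cycle =
    <-≤-trans ℓ<g (proj₂ (proj₂ (least hasGraphCycle? cycle)) m h)
  <girth⇒ _ m h | no ¬cycle = contradiction (m , h) ¬cycle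

  <girth⇐ : ∀ {ℓ} → (∀ m → HasGraphCycle m → ℓ < m) → [ ℓ ] <⁺ girth
  <girth⇐ long with anyLongCycle? _~?_ 3
  ... | no  _     = [ _ ]<⊤⁺
  ... | yes cycle with least hasGraphCycle? cycle
  ...   | g , h , _ = [ long g h ]

------------------------------------------------------------------------
-- Digraphs, dichromatic number, tournaments

-- Digraphs are loopless (otherwise the dichromatic number need not exist),
-- but pairs of opposite arcs are allowed.
record Digraph : Set₁ where
  field
    order : ℕ
  Vertex : Set
  Vertex = Fin order
  field
    _⟶_   : Rel Vertex 0ℓ
    ⟶-irr : Irreflexive _≡_ _⟶_
    _⟶?_  : B.Decidable _⟶_

-- As for graphs, up to renaming the vertices of H.
record _⊆ᴰ_ (H D : Digraph) : Set where
  private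
    module H = Digraph H
    module D = Digraph D
  field
    embed     : H.Vertex → D.Vertex
    injective : Injective _≡_ _≡_ embed
    arcs      : ∀ {u v} → u H.⟶ v → embed u D.⟶ embed v

IsTournament : Digraph → Set
IsTournament T = ∀ u v → u ≢ v →
  (u ⟶ v × ¬ (v ⟶ u)) ⊎ (v ⟶ u × ¬ (u ⟶ v))
  where open Digraph T

underlying : Digraph → Graph
underlying D = record
  { order = order
  ; _~_   = λ u v → u ⟶ v ⊎ v ⟶ u
  ; ~-sym = swap
  ; ~-irr = λ { refl (inj₁ a) → ⟶-irr refl a ; refl (inj₂ a) → ⟶-irr refl a }
  ; _~?_  = λ u v → (u ⟶? v) ⊎-dec (v ⟶? u)
  }
  where open Digraph D

girth⃗ : Digraph → ℕ ⁺
girth⃗ D = girth (underlying D)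

module _ (D : Digraph) where
  open Digraph D

  -- The colour classes are the parts of the partition, some possibly empty.
  IsDicolouring : ∀ {k} → (Vertex → Fin k) → Set
  IsDicolouring c = ∀ i → Acyclic (Induced _⟶_ (λ v → c v ≡ i))

  Dicolourable : ℕ → Set
  Dicolourable k = ∃ λ (c : Vertex → Fin k) → IsDicolouring c

  dicolourable? : Decidable Dicolourable
  dicolourable? k = anyFun?
    (λ f≗g col i → acyclic-mono
      (λ { {u} {v} (a , p , q) → a , trans (f≗g u) p , trans (f≗g v) q }) (col i))
    (λ c → all? λ i → acyclic? λ u v → (u ⟶? v) ×-dec ((c u ≟ i) ×-dec (c v ≟ i)))

  order-dicolourable : Dicolourable order
  order-dicolourable = id , singleton-acyclic
    where
    singleton-acyclic : IsDicolouring id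
    singleton-acyclic i (suc m) _ (c , cyc) with IsCycle.consecutive cyc zero
    ... | a , p , q = ⟶-irr (trans p (sym q)) a

  private
    leastDicolouring : ∃ (IsLeast Dicolourable)
    leastDicolouring = least dicolourable? (order , order-dicolourable)

  χ⃗ : ℕ
  χ⃗ = proj₁ leastDicolouring

  χ⃗-isLeast : IsLeast Dicolourable χ⃗
  χ⃗-isLeast = proj₂ leastDicolouring

-- Order the vertices of G and let T be the tournament in which exactly the
-- edges of G point backwards.  If H ⊆ T, then a set independent in the graph
-- H ∩ G spans only forward arcs of H, so H ∩ G has chromatic number at least
-- χ⃗ H, and no smaller girth.  Thus it suffices that χ⃗ T is large.  On a set
-- acyclic in T the relation "u < v and u ~ v" is transitive, so its chains are
-- cliques of G, and if G has no clique of size N then colouring by heights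
-- gives χ G ≤ χ⃗ T · N.  If G does have a clique of size N, where N is the order
-- of some tournament T₀ with χ⃗ T₀ large, then T₀ itself replaces T.
{-# OPTIONS --safe #-}
module Submission where

open import Defs
open import Data.Empty using (⊥)
open import Data.Fin as Fin using (Fin; zero; suc; toℕ; combine; remQuot; punchIn; punchOut)
open import Data.Fin.Properties as Fin
  using (all?; any?; <-cmp; toℕ<n; remQuot-combine; combine-remQuot;
         combine-injectiveˡ; combine-injectiveʳ; punchIn-punchOut)
open import Data.Nat using (ℕ; zero; suc; _*_; _≤_; _<_; _≥_; _>_; z≤n; s≤s)
open import Data.Nat.Properties
  using (≤-trans; <-≤-trans; <⇒≤; <⇒≱; ≮⇒≥; *-monoˡ-≤)
open import Data.Product as Product using (∃; _×_; _,_; proj₁; proj₂)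
open import Data.Sum as Sum using (_⊎_; inj₁; inj₂)
open import Data.Unit using (⊤; tt)
open import Function using (_∘_; id)
open import Function.Definitions using (Injective)
open import Level using (0ℓ)
open import Relation.Binary using (Rel; Irreflexive; Transitive; tri<; tri≈; tri>)
import Relation.Binary as B
open import Relation.Binary.Construct.Add.Supremum.Strict _<_ using (_<⁺_)
open import Relation.Binary.PropositionalEquality
  using (_≡_; _≢_; refl; sym; trans; cong; subst₂)
open import Relation.Nullary using (¬_; yes; no; contradiction)
open import Relation.Nullary.Construct.Add.Supremum using ([_])
open import Relation.Nullary.Decidable using (from-yes; ¬?; _×-dec_; _⊎-dec_; _→-dec_)
open import Relation.Unary using (Pred; Decidable)

-- Cycles and acyclicity

private
  variable
    m n : ℕ
    R S : Rel (Fin n) 0ℓ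

hasCycle-map : {f : Fin m → Fin n} → Injective _≡_ _≡_ f →
               (∀ {u v} → R u v → S (f u) (f v)) →
               ∀ {l} → HasCycle R l → HasCycle S l
hasCycle-map {f = f} f-injective R⇒S (c , cyc) = f ∘ c , record
  { distinct    = IsCycle.distinct cyc ∘ f-injective
  ; consecutive = R⇒S ∘ IsCycle.consecutive cyc
  }

-- Any two of the three vertices are joined by one of the given pairs, so irreflexivity makes them
-- distinct.
triangle : Irreflexive _≡_ R → ∀ {a b c} → R a b → R b c → R c a → HasCycle R 3
triangle {R = R} irr {a} {b} {c} ab bc ca = vertices , record
  { distinct    = distinct _ _
  ; consecutive = λ { zero → ab ; (suc zero) → bc ; (suc (suc zero)) → ca }
  }
  where
  vertices : Fin 3 → _
  vertices zero             = a
  vertices (suc zero)       = b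
  vertices (suc (suc zero)) = c

  distinct : ∀ i j → vertices i ≡ vertices j → i ≡ j
  distinct zero             zero             _  = refl
  distinct zero             (suc zero)       eq = contradiction ab (irr eq)
  distinct zero             (suc (suc zero)) eq = contradiction ca (irr (sym eq))
  distinct (suc zero)       zero             eq = contradiction ab (irr (sym eq))
  distinct (suc zero)       (suc zero)       _  = refl
  distinct (suc zero)       (suc (suc zero)) eq = contradiction bc (irr eq)
  distinct (suc (suc zero)) zero             eq = contradiction ca (irr eq)
  distinct (suc (suc zero)) (suc zero)       eq = contradiction bc (irr (sym eq))
  distinct (suc (suc zero)) (suc (suc zero)) _  = refl

-- Each step along a cycle raises the rank, so `n` steps reach a vertex of rank at least `n`, which
-- `Fin n` rules out.
increasing⇒acyclic : (rank : Fin m → Fin n) → (∀ {u v} → R u v → rank u Fin.< rank v) →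
                     Acyclic R
increasing⇒acyclic {n = n} rank increasing (suc l) _ (c , cyc) =
  let i , n≤ = climb n in <⇒≱ (toℕ<n (rank (c i))) n≤
  where
  climb : ∀ j → ∃ λ i → j ≤ toℕ (rank (c i))
  climb zero    = zero , z≤n
  climb (suc j) =
    let i , j≤ = climb j in next i , ≤-trans (s≤s j≤) (increasing (IsCycle.consecutive cyc i))

-- Chains and heights

last-true : {P : Pred ℕ 0ℓ} → Decidable P → ∀ w → P 0 → ¬ P w →
            ∃ λ (i : Fin w) → P (toℕ i) × ¬ P (suc (toℕ i))
last-true P? zero    p₀ ¬pw = contradiction p₀ ¬pw
last-true P? (suc w) p₀ ¬pw with P? 1
... | no  ¬p₁ = zero , p₀ , ¬p₁
... | yes p₁  = Product.map suc id (last-true (P? ∘ suc) w p₁ ¬pw)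

-- A descending walk of `l` steps from `v`. It is a chain once `R` is transitive, and its recursive
-- form makes it decidable by finite search.
ChainBelow : Rel (Fin n) 0ℓ → ℕ → Fin n → Set
ChainBelow R zero    v = ⊤
ChainBelow R (suc l) v = ∃ λ u → R u v × ChainBelow R l u

chainBelow? : B.Decidable R → ∀ l → Decidable (ChainBelow R l)
chainBelow? R? zero    v = yes tt
chainBelow? R? (suc l) v = any? λ u → R? u v ×-dec chainBelow? R? l u

chain-elements : Transitive R → ∀ l v → ChainBelow R l v →
  ∃ λ (g : Fin l → Fin n) → (∀ i → R (g i) v) ×
    (∀ i j → i ≢ j → R (g i) (g j) ⊎ R (g j) (g i))
chain-elements R-trans zero v _ = (λ ()) , (λ ()) , λ ()
chain-elements {n = n} {R = R} R-trans (suc l) v (u , u<v , below)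
  with chain-elements R-trans l u below
... | g , g<u , comparable = g⁺ , g⁺<v , comparable⁺
  where
  g⁺ : Fin (suc l) → Fin n
  g⁺ zero    = u
  g⁺ (suc i) = g i

  g⁺<v : ∀ i → R (g⁺ i) v
  g⁺<v zero    = u<v
  g⁺<v (suc i) = R-trans (g<u i) u<v

  comparable⁺ : ∀ i j → i ≢ j → R (g⁺ i) (g⁺ j) ⊎ R (g⁺ j) (g⁺ i)
  comparable⁺ zero    zero    0≢0 = contradiction refl 0≢0
  comparable⁺ zero    (suc j) _   = inj₂ (g<u j)
  comparable⁺ (suc i) zero    _   = inj₁ (g<u i)
  comparable⁺ (suc i) (suc j) i≢j = comparable i j (i≢j ∘ cong suc)

chain-or-height : B.Decidable R → ∀ w →
  ∃ (ChainBelow R w) ⊎ ∃ λ (h : Fin n → Fin w) → ∀ {u v} → R u v → h u ≢ h v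
chain-or-height {n = n} {R = R} R? w with any? (chainBelow? R? w)
... | yes chain  = inj₁ chain
... | no  ¬chain = inj₂ (proj₁ ∘ height , separates)
  where
  height : ∀ v → ∃ λ (i : Fin w) → ChainBelow R (toℕ i) v × ¬ ChainBelow R (suc (toℕ i)) v
  height v = last-true (λ l → chainBelow? R? l v) w tt (λ below → ¬chain (v , below))

  separates : ∀ {u v} → R u v → proj₁ (height u) ≢ proj₁ (height v)
  separates {u} {v} uv eq with height u | height v
  -- The walk below `u`, extended by `u`, is one step too long for the common height of `u` and `v`.
  separates {u} {v} uv refl | _ , below , _ | _ , _ , ¬below = ¬below (u , uv , below)

-- Tournaments of large dichromatic number

-- Each class of `c′` embeds into a class of `c`. The renaming `σ` is the identity for plain
-- restriction, and `punchIn zero` when a colour missing on `H` is dropped.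
dicolouring-restrict : ∀ {H D} (H⊆D : H ⊆ᴰ D) (let open _⊆ᴰ_ H⊆D) {j k}
  {c : Digraph.Vertex D → Fin k} {c′ : Digraph.Vertex H → Fin j} (σ : Fin j → Fin k) →
  (∀ v → σ (c′ v) ≡ c (embed v)) → IsDicolouring D c → IsDicolouring H c′
dicolouring-restrict H⊆D σ σc′≡c dic i l 1≤l cyc = dic (σ i) l 1≤l
  (hasCycle-map injective
    (λ { (a , p , q) → arcs a , trans (sym (σc′≡c _)) (cong σ p) , trans (sym (σc′≡c _)) (cong σ q) })
    cyc)
  where open _⊆ᴰ_ H⊆D

-- This and the next two facts say that the arcs from `i` to `next i` make `Fin 3` a tournament, the
-- directed triangle.
next-irr : ∀ (i : Fin 3) → next i ≢ i
next-irr = from-yes (all? λ (i : Fin 3) → ¬? (next i Fin.≟ i))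

next-asym : ∀ (i j : Fin 3) → next i ≡ j → next j ≢ i
next-asym = from-yes (all? λ (i : Fin 3) → all? λ (j : Fin 3) →
  (next i Fin.≟ j) →-dec ¬? (next j Fin.≟ i))

next-total : ∀ (i j : Fin 3) → i ≢ j → next i ≡ j ⊎ next j ≡ i
next-total = from-yes (all? λ (i : Fin 3) → all? λ (j : Fin 3) →
  ¬? (i Fin.≟ j) →-dec ((next i Fin.≟ j) ⊎-dec (next j Fin.≟ i)))

-- The lexicographic product of the directed triangle with D.
module Triple (D : Digraph) where
  open Digraph D

  Arc : Rel (Fin 3 × Vertex) 0ℓ
  Arc (i , a) (j , b) = next i ≡ j ⊎ (i ≡ j × a ⟶ b)

  Arc? : B.Decidable Arc
  Arc? (i , a) (j , b) = (next i Fin.≟ j) ⊎-dec ((i Fin.≟ j) ×-dec (a ⟶? b))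

  Arc-irr : Irreflexive _≡_ Arc
  Arc-irr refl (inj₁ eq)      = next-irr _ eq
  Arc-irr refl (inj₂ (_ , a)) = ⟶-irr refl a

  triple : Digraph
  triple = record
    { order = 3 * order
    ; _⟶_   = λ u v → Arc (remQuot order u) (remQuot order v)
    ; ⟶-irr = Arc-irr ∘ cong (remQuot order)
    ; _⟶?_  = λ u v → Arc? (remQuot order u) (remQuot order v)
    }

  arc : ∀ {i j a b} → Arc (i , a) (j , b) → Digraph._⟶_ triple (combine i a) (combine j b)
  arc {i} {j} {a} {b} = subst₂ Arc (sym (remQuot-combine i a)) (sym (remQuot-combine j b))

  copy : Fin 3 → D ⊆ᴰ triple
  copy i = record
    { embed     = combine i
    ; injective = λ {a} {b} → combine-injectiveʳ i a i b
    ; arcs      = λ {a} {b} a⟶b → arc {i} {i} {a} {b} (inj₂ (refl , a⟶b))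
    }

  triple-isTournament : IsTournament D → IsTournament triple
  triple-isTournament D-tour u v u≢v =
    pairs _ _ λ eq → u≢v (trans (sym (combine-remQuot order u))
      (trans (cong (λ (i , a) → combine i a) eq) (combine-remQuot order v)))
    where
    pairs : ∀ x y → x ≢ y → (Arc x y × ¬ Arc y x) ⊎ (Arc y x × ¬ Arc x y)
    pairs (i , a) (j , b) x≢y with i Fin.≟ j
    ... | yes refl = Sum.map within within (D-tour a b (x≢y ∘ cong (i ,_)))
      where
      within : ∀ {a b} → a ⟶ b × ¬ (b ⟶ a) → Arc (i , a) (i , b) × ¬ Arc (i , b) (i , a)
      within (a⟶b , b↛a) = inj₂ (refl , a⟶b) ,
        λ { (inj₁ eq) → next-irr i eq ; (inj₂ (_ , b⟶a)) → b↛a b⟶a }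
    ... | no i≢j = Sum.map (across i≢j) (across (i≢j ∘ sym)) (next-total i j i≢j)
      where
      across : ∀ {i j a b} → i ≢ j → next i ≡ j →
               Arc (i , a) (j , b) × ¬ Arc (j , b) (i , a)
      across i≢j eq = inj₁ eq ,
        λ { (inj₁ eq′) → next-asym _ _ eq eq′ ; (inj₂ (j≡i , _)) → i≢j (sym j≡i) }

  -- If a colour is missing from one of the copies, that copy needs fewer
  -- colours; otherwise the copies contain a monochromatic directed triangle.
  triple-dichromatic : ∀ {k} → (∀ j → Dicolourable D j → k < j) →
                       ∀ j → Dicolourable triple j → suc k < j
  triple-dichromatic {k} k<D j (c , dic)
    -- Restriction to one copy gives `k < j`, so `j` is a successor and the colour `zero` exists.
    with j | c | dic | k<D j (_ , dicolouring-restrict (copy zero) id (λ _ → refl) dic)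
  ... | suc j | c | dic | _
    with all? (λ i → any? (λ a → zero Fin.≟ c (combine i a)))
  ... | yes present = contradiction
          (triangle {R = Induced (Digraph._⟶_ triple) (λ v → c v ≡ zero)}
            (λ eq (a , _) → Digraph.⟶-irr triple eq a)
            (side zero) (side (suc zero)) (side (suc (suc zero))))
          (dic zero 3 (s≤s z≤n))
    where
    side : ∀ i → Induced (Digraph._⟶_ triple) (λ v → c v ≡ zero)
      (combine i (proj₁ (present i))) (combine (next i) (proj₁ (present (next i))))
    side i = arc {i} {next i} (inj₁ refl) , sym (proj₂ (present i)) , sym (proj₂ (present (next i)))
  ... | no ¬present with Fin.¬∀⟶∃¬ 3 _ (λ i → any? (λ a → zero Fin.≟ c (combine i a))) ¬present
  ...   | i , missing = s≤s (k<D j (c′ , dicolouring-restrict (copy i) (punchIn zero)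
            (λ v → punchIn-punchOut (avoids v)) dic))
    where
    avoids : ∀ v → zero ≢ c (combine i v)
    avoids v eq = missing (v , eq)

    c′ : Vertex → Fin j
    c′ v = punchOut (avoids v)

open Triple using (triple; triple-isTournament; triple-dichromatic)

point : Digraph
point = record
  { order = 1
  ; _⟶_   = λ _ _ → ⊥
  ; ⟶-irr = λ _ ()
  ; _⟶?_  = λ _ _ → no λ ()
  }

-- Each tripling forces one more colour, starting from a single vertex.
uncolourable-tournament : ∀ k → ∃ λ T → IsTournament T × (∀ j → Dicolourable T j → k < j)
uncolourable-tournament zero = point , (λ { zero zero 0≢0 → contradiction refl 0≢0 }) , positive
  where
  positive : ∀ j → Dicolourable point j → 0 < j
  positive j (c , _) with c zero
  positive (suc j) _ | _ = s≤s z≤n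
uncolourable-tournament (suc k) =
  let T , T-tour , k<T = uncolourable-tournament k
  in  triple T , triple-isTournament T T-tour , triple-dichromatic T k<T

tournament-with-χ⃗> : ∀ k → ∃ λ T → IsTournament T × k < χ⃗ T
tournament-with-χ⃗> k =
  let T , T-tour , k<T = uncolourable-tournament k
  in  T , T-tour , k<T (χ⃗ T) (proj₁ (χ⃗-isLeast T))

-- Subgraphs common to a graph and a tournament

module _ (H : Digraph) (G : Graph) (e : Digraph.Vertex H → Graph.Vertex G) where
  private
    module H = Digraph H
    module U = Graph (underlying H)
    module G = Graph G

  meet : Graph
  meet = record
    { order = H.order
    ; _~_   = λ u v → u U.~ v × e u G.~ e v
    ; ~-sym = Product.map U.~-sym G.~-sym
    ; ~-irr = λ eq (a , _) → U.~-irr eq a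
    ; _~?_  = λ u v → (u U.~? v) ×-dec (e u G.~? e v)
    }

  meet-girth : ∀ {ℓ} → [ ℓ ] <⁺ girth⃗ H → [ ℓ ] <⁺ girth meet
  meet-girth ℓ<g = <girth⇐ meet λ m (3≤m , cyc) →
    <girth⇒ (underlying H) ℓ<g m (3≤m , hasCycle-map id proj₁ cyc)

  -- A proper colouring of `meet` is a dicolouring of `H`: an arc inside a colour class is no edge
  -- of `meet`, hence goes forward, and `e` serves as a rank.
  χ⃗≤χ-meet : (∀ {u v} → u H.⟶ v → e u G.~ e v ⊎ e u Fin.< e v) → χ⃗ H ≤ χ meet
  χ⃗≤χ-meet edge-or-forward with proj₁ (χ-isLeast meet)
  ... | c , col = proj₂ (χ⃗-isLeast H) (χ meet) (c , λ i → increasing⇒acyclic e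
          λ (u⟶v , cu≡i , cv≡i) → Sum.[
            (λ eu~ev → contradiction (trans cu≡i (sym cv≡i)) (col _ _ (inj₁ u⟶v , eu~ev))) ,
            id ] (edge-or-forward u⟶v))

HighGirthSubdigraph : ℕ → ℕ → Digraph → Set₁
HighGirthSubdigraph k ℓ D =
  ∃ λ (H : Digraph) → (H ⊆ᴰ D) × (χ⃗ H > k) × ([ ℓ ] <⁺ girth⃗ H)

HighGirthSubgraph : ℕ → ℕ → Graph → Set₁
HighGirthSubgraph k ℓ G =
  ∃ λ (H : Graph) → (H ⊆ᴳ G) × (χ H > k) × ([ ℓ ] <⁺ girth H)

-- The disjunction covers both cases of the proof: in a clique every arc lies on an edge of `G`, and
-- in the backedge tournament the arcs off the edges go forward.
subgraph-transfer : ∀ (T : Digraph) (G : Graph) {e : Digraph.Vertex T → Graph.Vertex G} →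
  Injective _≡_ _≡_ e →
  (∀ {u v} → Digraph._⟶_ T u v → Graph._~_ G (e u) (e v) ⊎ e u Fin.< e v) →
  ∀ k ℓ → HighGirthSubdigraph k ℓ T → HighGirthSubgraph k ℓ G
subgraph-transfer T G {e} e-injective edge-or-forward k ℓ (H , H⊆T , k<χ⃗ , ℓ<girth) =
  meet H G e′ ,
  record { embed = e′ ; injective = injective ∘ e-injective ; edges = proj₂ } ,
  <-≤-trans k<χ⃗ (χ⃗≤χ-meet H G e′ (edge-or-forward ∘ arcs)) ,
  meet-girth H G e′ ℓ<girth
  where
  open _⊆ᴰ_ H⊆T

  e′ : Digraph.Vertex H → Graph.Vertex G
  e′ = e ∘ embed

-- Cliques and the backedge tournament

IsClique : (G : Graph) → (Fin n → Graph.Vertex G) → Set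
IsClique G g = ∀ i j → i ≢ j → g i ~ g j
  where open Graph G

clique-injective : ∀ G {g : Fin n → Graph.Vertex G} → IsClique G g → Injective _≡_ _≡_ g
clique-injective G clique {i} {j} gi≡gj with i Fin.≟ j
... | yes i≡j = i≡j
... | no  i≢j = contradiction (clique i j i≢j) (Graph.~-irr G gi≡gj)

module _ (G : Graph) where
  open Graph G

  backedge : Digraph
  backedge = record
    { order = order
    ; _⟶_   = λ u v → (u Fin.< v × ¬ u ~ v) ⊎ (v Fin.< u × u ~ v)
    ; ⟶-irr = λ { refl (inj₁ (u<u , _)) → Fin.<-irrefl refl u<u
                ; refl (inj₂ (u<u , _)) → Fin.<-irrefl refl u<u }
    ; _⟶?_  = λ u v → ((u Fin.<? v) ×-dec ¬? (u ~? v)) ⊎-dec ((v Fin.<? u) ×-dec (u ~? v))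
    }

  open Digraph backedge using (_⟶_)

  ordered : ∀ u v → u Fin.< v → (u ⟶ v × ¬ (v ⟶ u)) ⊎ (v ⟶ u × ¬ (u ⟶ v))
  ordered u v u<v with u ~? v
  ... | yes u~v = inj₂ (inj₂ (u<v , ~-sym u~v) , λ where
          (inj₁ (_ , u≁v)) → u≁v u~v
          (inj₂ (v<u , _)) → Fin.<-asym u<v v<u)
  ... | no  u≁v = inj₁ (inj₁ (u<v , u≁v) , λ where
          (inj₁ (v<u , _)) → Fin.<-asym u<v v<u
          (inj₂ (_ , v~u)) → u≁v (~-sym v~u))

  backedge-isTournament : IsTournament backedge
  backedge-isTournament u v u≢v with <-cmp u v
  ... | tri< u<v _ _ = ordered u v u<v
  ... | tri≈ _ u≡v _ = contradiction u≡v u≢v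
  ... | tri> _ _ v<u = Sum.swap (ordered v u v<u)

  module _ {k} (c : Vertex → Fin k) (dic : IsDicolouring backedge c) where

    -- Requiring equal colours puts all classes into one relation, so a single height function
    -- serves them all.
    _≺_ : Rel Vertex 0ℓ
    u ≺ v = c u ≡ c v × u Fin.< v × u ~ v

    _≺?_ : B.Decidable _≺_
    u ≺? v = (c u Fin.≟ c v) ×-dec ((u Fin.<? v) ×-dec (u ~? v))

    -- If u ≁ x, then u ⟶ x ⟶ v ⟶ u would be a monochromatic directed triangle.
    ≺-trans : Transitive _≺_
    ≺-trans {u} {v} {x} (cu≡cv , u<v , u~v) (cv≡cx , v<x , v~x) with u ~? x
    ... | yes u~x = trans cu≡cv cv≡cx , Fin.<-trans u<v v<x , u~x
    ... | no  u≁x = contradiction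
            (triangle {R = Induced _⟶_ (λ y → c y ≡ c v)}
              (λ eq (a , _) → Digraph.⟶-irr backedge eq a)
              (inj₁ (Fin.<-trans u<v v<x , u≁x) , cu≡cv , sym cv≡cx)
              (inj₂ (v<x , ~-sym v~x) , sym cv≡cx , refl)
              (inj₂ (u<v , ~-sym u~v) , refl , cu≡cv))
            (dic (c v) 3 (s≤s z≤n))

    clique-or-colouring : ∀ w → (∃ λ (g : Fin w → Vertex) → IsClique G g) ⊎ Colourable G (k * w)
    clique-or-colouring w with chain-or-height _≺?_ w
    ... | inj₁ (v , below) =
            let g , _ , comparable = chain-elements ≺-trans w v below
            in  inj₁ (g , λ i j i≢j → Sum.[ (λ (_ , _ , i~j) → i~j) , (λ (_ , _ , j~i) → ~-sym j~i) ]
                  (comparable i j i≢j))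
    -- The new colour pairs class with height: adjacent vertices of the same class are related by
    -- `≺` one way or the other, so their heights differ.
    ... | inj₂ (h , separates) = inj₂ ((λ v → combine (c v) (h v)) , proper)
      where
      distinct : ∀ u v → u ≺ v → combine (c u) (h u) ≢ combine (c v) (h v)
      distinct u v u≺v eq = separates u≺v (combine-injectiveʳ (c u) (h u) (c v) (h v) eq)

      proper : IsColouring G (λ v → combine (c v) (h v))
      proper u v u~v eq with combine-injectiveˡ (c u) (h u) (c v) (h v) eq | <-cmp u v
      ... | cu≡cv | tri< u<v _ _ = distinct u v (cu≡cv , u<v , u~v) eq
      ... | cu≡cv | tri≈ _ u≡v _ = ~-irr u≡v u~v
      ... | cu≡cv | tri> _ _ v<u = distinct v u (sym cu≡cv , v<u , ~-sym u~v) (sym eq)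

  clique-or-χ≤ : ∀ w → (∃ λ (g : Fin w → Vertex) → IsClique G g) ⊎ χ G ≤ χ⃗ backedge * w
  clique-or-χ≤ w =
    let c , dic = proj₁ (χ⃗-isLeast backedge)
    in  Sum.map₂ (proj₂ (χ-isLeast G) _) (clique-or-colouring c dic w)

-- The bound on the chromatic number

≤-quotient : ∀ {f n x d} → f * n < x → x ≤ d * n → f ≤ d
≤-quotient {n = n} fn<x x≤dn = ≮⇒≥ λ d<f → <⇒≱ fn<x (≤-trans x≤dn (*-monoˡ-≤ n (<⇒≤ d<f)))

clique⇒subgraph : ∀ (T : Digraph) (G : Graph) {g : Digraph.Vertex T → Graph.Vertex G} →
  IsClique G g → ∀ k ℓ → HighGirthSubdigraph k ℓ T → HighGirthSubgraph k ℓ G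
clique⇒subgraph T G clique = subgraph-transfer T G (clique-injective G clique)
  λ u⟶v → inj₁ (clique _ _ λ u≡v → Digraph.⟶-irr T u≡v u⟶v)

backedge⇒subgraph : ∀ (G : Graph) k ℓ →
  HighGirthSubdigraph k ℓ (backedge G) → HighGirthSubgraph k ℓ G
backedge⇒subgraph G = subgraph-transfer (backedge G) G id Sum.[ inj₂ ∘ proj₁ , inj₁ ∘ proj₂ ]

large-χ⇒subgraph : ∀ k ℓ f →
  (∀ T → IsTournament T → χ⃗ T ≥ f → HighGirthSubdigraph k ℓ T) →
  ∃ λ f′ → ∀ G → χ G ≥ f′ → HighGirthSubgraph k ℓ G
large-χ⇒subgraph k ℓ f large⇒H with tournament-with-χ⃗> f
-- `T₀` depends only on `f`, so its order may enter the bound. The successor gives `f * N < χ G`;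
-- without a clique of size `N` also `χ G ≤ χ⃗ (backedge G) * N`, and together these force
-- `f ≤ χ⃗ (backedge G)`.
... | T₀ , T₀-tour , f<χ⃗ = suc (f * N) , λ G → conclude G (clique-or-χ≤ G N)
  where
  N : ℕ
  N = Digraph.order T₀

  conclude : ∀ G → (∃ λ (g : Fin N → Graph.Vertex G) → IsClique G g) ⊎ χ G ≤ χ⃗ (backedge G) * N →
    f * N < χ G → HighGirthSubgraph k ℓ G
  conclude G (inj₁ (g , clique)) _ =
    clique⇒subgraph T₀ G clique k ℓ (large⇒H T₀ T₀-tour (<⇒≤ f<χ⃗))
  conclude G (inj₂ χ≤) fN<χ = backedge⇒subgraph G k ℓ
    (large⇒H (backedge G) (backedge-isTournament G)
      (≤-quotient {f} {N} {χ G} {χ⃗ (backedge G)} fN<χ χ≤))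

theorem4 : (∀ (k ℓ : ℕ) → 3 ≤ ℓ → ∃ λ (f : ℕ) →
    ∀ (T : Digraph) → IsTournament T → χ⃗ T ≥ f →
    ∃ λ (H : Digraph) → (H ⊆ᴰ T) × (χ⃗ H > k) × ([ ℓ ] <⁺ girth⃗ H)) →
    (∀ (k ℓ : ℕ) → 3 ≤ ℓ → ∃ λ (f′ : ℕ) →
    ∀ (G : Graph) → χ G ≥ f′ →
    ∃ λ (H : Graph) → (H ⊆ᴳ G) × (χ H > k) × ([ ℓ ] <⁺ girth H))
theorem4 hyp k ℓ 3≤ℓ =
  let f , large⇒H = hyp k ℓ 3≤ℓ in large-χ⇒subgraph k ℓ f large⇒H
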